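{- Fix any integer $k\ge 3$. Then, for every integer $r\ge 1$, the $k$-graph $F^k_r$ is not $r$-colourable and satisfies $\gamma(F^k_r)=\frac{r-1}{r}$.
   Context: A $k$-graph ($k$-uniform hypergraph) $H$ consists of a vertex set $V(H)$ and an edge set $E(H)\subseteq\binom{V(H)}{k}$. For a $(k-1)$-subset $S\subseteq V(H)$, $d_H(S)$ is the number of edges of $H$ containing $S$, and $\delta_{k-1}(H)$ is the minimum of $d_H(S)$ over all $(k-1)$-subsets $S$. For a $k$-graph $F$, $\mathrm{co\text{ - }ex}(n,F)$ is the maximum of $\delta_{k-1}(H)$ over all $n$-vertex $k$-graphs $H$ not containing $F$ as a (not necessarily induced) subgraph, and $\gamma(F)=\lim_{n\to\infty}\mathrm{co\text{ - }ex}(n,F)/n$ (this limit is known to exist). A $k$-graph $F$ is $r$-colourable if $V(F)$ can be partitioned into $r$ sets $A_1,\dots,A_r$ such that no edge of $F$ lies entirely inside some $A_i$. The $k$-graphs $F^k_r$ are defined inductively on $r$. $F^k_1$ is a single edge (a $k$-graph with $k$ vertices and one edge). For $r\ge 2$: let $S$ be a set of $r(k-2)+1$ vertices, let $m=\binom{r(k-2)+1}{k-1}$, and enumerate the $(k-1)$-subsets of $S$ as $X_1,\dots,X_m$. For each $j\in[m]$ let $\tilde X_j$ be a copy of $F^k_{r-1}$, these copies being pairwise vertex-disjoint and disjoint from $S$. Then $V(F^k_r)=S\cup\bigcup_{j=1}^m V(\tilde X_j)$ and \[E(F^k_r)=\{X_j\cup\{v\}: j\in[m],\ v\in V(\tilde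 X_j)\}\cup\bigcup_{j=1}^m E(\tilde X_j).\] -}

module Defs where

open import Data.Nat using (ℕ; zero; suc; _+_; _*_; _∸_; _≤_; NonZero)
open import Data.Bool using (Bool; true; false; if_then_else_; not; _∧_)
open import Data.Fin using (Fin)
open import Data.Fin.Subset using (Subset; ⁅_⁆; _∪_; ∣_∣; _∈_) renaming (⊥ to ∅)
open import Data.List using (List; []; _∷_; _++_; map; foldr; allFin; filterᵇ)
open import Data.Nat.ListAction using (sum)
open import Data.Vec using (lookup)
open import Data.Product using (Σ; ∃; _×_; _,_)
open import Data.Sum using (_⊎_; inj₁; inj₂)
open import Data.Unit using (⊤; tt)
open import Relation.Nullary using (¬_)
open import Relation.Binary.PropositionalEquality using (_≡_)
open import Function.Definitions using (Injective)
open import Data.Integer using (+_)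
open import Data.Rational using (ℚ; 0ℚ; _/_; _-_; _<_) renaming (∣_∣ to abs)

-- Abstract finite k-graphs (used for the forbidden graph F).
-- A vertex type V, an index type of edges, and for each edge index the
-- list of its vertices (for the graphs F^k_r below these are k distinct
-- vertices, and distinct indices give distinct edges).

record AbsGraph : Set₁ where
  field
    V    : Set
    Ix   : Set
    edge : Ix → List V
open AbsGraph public

Colourable : ℕ → AbsGraph → Set
Colourable r F =
  Σ (V F → Fin r) λ c →
    (e : Ix F) → ¬ (Σ (Fin r) λ i → ∀ v → Data.List.Membership.Propositional._∈_ v (edge F e) → c v ≡ i)
  where import Data.List.Membership.Propositional

-- Host k-graphs on the vertex set Fin n: the edges are the k-subsets S
-- with E S ≡ true (the value of E on sets of other sizes is irrelevant).

record KGraph (k n : ℕ) : Set where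
  field
    E : Subset n → Bool
open KGraph public

IsEdge : ∀ {k n} → KGraph k n → Subset n → Set
IsEdge {k} H S = ∣ S ∣ ≡ k × E H S ≡ true

codeg : ∀ {k n} → KGraph k n → Subset n → ℕ
codeg {k} {n} H S =
  sum (map (λ v → if not (lookup S v) ∧ E H (S ∪ ⁅ v ⁆) then 1 else 0) (allFin n))

MinCodeg : ∀ {k n} → KGraph k n → ℕ → Set
MinCodeg {k} H c =
  (∀ S → ∣ S ∣ ≡ k ∸ 1 → c ≤ codeg H S) ×
  (Σ _ λ S → ∣ S ∣ ≡ k ∸ 1 × codeg H S ≡ c)

image : ∀ {n} {A : Set} → (A → Fin n) → List A → Subset n
image f = foldr (λ v S → ⁅ f v ⁆ ∪ S) ∅

Contains : ∀ {k n} → KGraph k n → AbsGraph → Set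
Contains {k} {n} H F =
  Σ (V F → Fin n) λ f → Injective _≡_ _≡_ f × ((e : Ix F) → IsEdge H (image f (edge F e)))

IsCoex : (k n : ℕ) → AbsGraph → ℕ → Set
IsCoex k n F c =
  (Σ (KGraph k n) λ H → ¬ Contains H F × MinCodeg H c) ×
  (∀ (H : KGraph k n) c' → ¬ Contains H F → MinCodeg H c' → c' ≤ c)

Gamma≡ : ℕ → AbsGraph → ℚ → Set
Gamma≡ k F L =
  ∀ (ε : ℚ) → 0ℚ < ε → Σ ℕ λ N → ∀ m → N ≤ m →
    Σ ℕ λ c → IsCoex k (suc m) F c × abs ((+ c) / suc m - L) < ε

members : ∀ {s} → Subset s → List (Fin s)
members {s} X = filterᵇ (lookup X) (allFin s)

KSub : ℕ → ℕ → Set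
KSub k s = Σ (Subset s) λ X → ∣ X ∣ ≡ k ∸ 1

singleEdge : ℕ → AbsGraph
singleEdge k = record { V = Fin k ; Ix = ⊤ ; edge = λ _ → allFin k }

-- step r G : F^k_r built from G = F^k_{r-1}, with |S| = r(k-2)+1
step : (k r : ℕ) → AbsGraph → AbsGraph
step k r G = record
  { V    = Fin s ⊎ (KSub k s × V G)
  ; Ix   = (KSub k s × V G) ⊎ (KSub k s × Ix G)
  ; edge = ed
  }
  where
  s = r * (k ∸ 2) + 1
  ed : (KSub k s × V G) ⊎ (KSub k s × Ix G) → List (Fin s ⊎ (KSub k s × V G))
  ed (inj₁ (X , v)) = map inj₁ (members (Data.Product.proj₁ X)) ++ (inj₂ (X , v) ∷ [])
  ed (inj₂ (X , e)) = map (λ w → inj₂ (X , w)) (edge G e)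

-- Fsuc k i = F^k_{i+1}
Fsuc : ℕ → ℕ → AbsGraph
Fsuc k zero    = singleEdge k
Fsuc k (suc i) = step k (suc (suc i)) (Fsuc k i)

-- F^k_r for r ≥ 1 (the value at r = 0 is a dummy and never used)
F : ℕ → ℕ → AbsGraph
F k r = Fsuc k (r ∸ 1)

-- Call v a non-neighbour of a (k-1)-set X when X ∪ {v} is not an edge. If every (k-1)-set has at
-- most t non-neighbours, then any vertex set W with |W| ≥ r t + C_r contains a copy of F^k_r: pick
-- S in W arbitrarily and, for each X_j in turn, embed F^k_{r-1} in the part of W that consists of
-- unused neighbours of X_j, which has lost only t + O(1) vertices. With t = n - c and W everything,
-- an F^k_r-free host of minimum codegree c satisfies r c ≤ (r-1) n + O(1). Conversely, the k-sets
-- that are not monochromatic under v ↦ v mod r form a host of minimum codegree at least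
-- (r-1) n / r - O(1), and it is F^k_r-free because F^k_r is not r-colourable: among the
-- r (k-2) + 1 vertices of S some k - 1 share a colour, which is then unavailable on the copy of
-- F^k_{r-1} attached to them.

module Submission where

open import Defs
open import Data.Nat using (ℕ; zero; suc; _+_; _*_; _∸_; _≤_; _<_; z≤n; s≤s; s≤s⁻¹; NonZero)
import Data.Nat.Base as ℕ
open import Data.Nat.Properties
import Data.Bool as Bool
open import Data.Bool using (Bool; true; false; if_then_else_; not; _∧_)
open import Data.Fin using (Fin; zero; suc; toℕ; fromℕ<; punchIn; punchOut)
import Data.Fin.Properties as Fin
open import Data.Fin.Subset using (Subset; ⁅_⁆; _∪_; _─_; ∁; ∣_∣; _∈_; _∉_; ⊤) renaming (⊥ to ∅)
open import Data.Fin.Subset.Properties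
open import Data.List as List using (List; []; _∷_; _++_; map; length; allFin; filter; filterᵇ)
open import Data.List.Properties using (map-tabulate; map-cong; length-tabulate)
open import Data.List.Membership.Propositional as L using () renaming (_∈_ to _∈ₗ_)
import Data.List.Membership.Propositional.Properties as L
open import Data.List.Relation.Unary.Any using (here; there; any?)
import Data.List.Relation.Unary.All as All
import Data.List.Relation.Unary.All.Properties as All
open import Data.List.Relation.Unary.AllPairs using ([]; _∷_)
open import Data.List.Relation.Unary.Unique.Propositional using (Unique)
import Data.List.Relation.Unary.Unique.Propositional.Properties as Unique
open import Data.Nat.ListAction using (sum)
open import Data.Vec as Vec using ([]; _∷_; lookup; tabulate)
open import Data.Vec.Properties using (lookup∘tabulate; tabulate∘lookup; []=⇒lookup; lookup⇒[]=)
open import Data.Product using (Σ; ∃; _×_; _,_; proj₁; proj₂)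
open import Data.Sum using (_⊎_; inj₁; inj₂)
import Data.Sum.Properties as Sum
import Data.Product.Properties as Product
import Data.Vec.Properties as Vec
open import Data.Unit using (tt)
open import Data.Bool.Properties using (T?)
open import Data.List.Extrema.Nat using (argmin; argmax; argmax-all; f[argmin]≤f[xs]; f[xs]≤f[argmax])
open import Data.Nat.DivMod using (_%_; _mod_; m≡m%n+[m/n]*n; m/n*n≤m; /-monoˡ-≤)
open import Data.Nat.Tactic.RingSolver using (solve-∀)
open import Relation.Nullary using (¬_; Dec; yes; no; does; contradiction)
open import Relation.Nullary.Decidable using (dec-true; dec-false; map′; _×-dec_; _→-dec_; ¬?)
open import Relation.Unary using (Decidable)
open import Relation.Binary.Definitions using (DecidableEquality)
open import Relation.Binary.PropositionalEquality
open import Function using (_∘_; id)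
open import Function.Definitions using (Injective)

private
  variable
    n : ℕ
    A B : Set

-- Sizes of subsets and of images of lists.

∣p∣≤∣p─q∣+∣q∣ : (p q : Subset n) → ∣ p ∣ ≤ ∣ p ─ q ∣ + ∣ q ∣
∣p∣≤∣p─q∣+∣q∣ [] [] = z≤n
∣p∣≤∣p─q∣+∣q∣ (true ∷ p) (true ∷ q) =
  ≤-trans (s≤s (∣p∣≤∣p─q∣+∣q∣ p q)) (≤-reflexive (sym (+-suc _ _)))
∣p∣≤∣p─q∣+∣q∣ (true ∷ p) (false ∷ q) = s≤s (∣p∣≤∣p─q∣+∣q∣ p q)
∣p∣≤∣p─q∣+∣q∣ (false ∷ p) (true ∷ q) = ≤-trans (∣p∣≤∣p─q∣+∣q∣ p q) (+-monoʳ-≤ ∣ p ─ q ∣ (n≤1+n _))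
∣p∣≤∣p─q∣+∣q∣ (false ∷ p) (false ∷ q) = ∣p∣≤∣p─q∣+∣q∣ p q

∣p∪q∣≤∣p∣+∣q∣ : (p q : Subset n) → ∣ p ∪ q ∣ ≤ ∣ p ∣ + ∣ q ∣
∣p∪q∣≤∣p∣+∣q∣ [] [] = z≤n
∣p∪q∣≤∣p∣+∣q∣ (true ∷ p) (true ∷ q) =
  s≤s (≤-trans (∣p∪q∣≤∣p∣+∣q∣ p q) (+-monoʳ-≤ ∣ p ∣ (n≤1+n _)))
∣p∪q∣≤∣p∣+∣q∣ (true ∷ p) (false ∷ q) = s≤s (∣p∪q∣≤∣p∣+∣q∣ p q)
∣p∪q∣≤∣p∣+∣q∣ (false ∷ p) (true ∷ q) =
  ≤-trans (s≤s (∣p∪q∣≤∣p∣+∣q∣ p q)) (≤-reflexive (sym (+-suc _ _)))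
∣p∪q∣≤∣p∣+∣q∣ (false ∷ p) (false ∷ q) = ∣p∪q∣≤∣p∣+∣q∣ p q

x∉p⇒∣⁅x⁆∪p∣≡1+∣p∣ : (x : Fin n) (p : Subset n) → x ∉ p → ∣ ⁅ x ⁆ ∪ p ∣ ≡ suc ∣ p ∣
x∉p⇒∣⁅x⁆∪p∣≡1+∣p∣ zero (true ∷ p) x∉p = contradiction Vec.here x∉p
x∉p⇒∣⁅x⁆∪p∣≡1+∣p∣ zero (false ∷ p) x∉p = cong (suc ∘ ∣_∣) (∪-identityˡ p)
x∉p⇒∣⁅x⁆∪p∣≡1+∣p∣ (suc x) (true ∷ p) x∉p = cong suc (x∉p⇒∣⁅x⁆∪p∣≡1+∣p∣ x p (x∉p ∘ Vec.there))
x∉p⇒∣⁅x⁆∪p∣≡1+∣p∣ (suc x) (false ∷ p) x∉p = x∉p⇒∣⁅x⁆∪p∣≡1+∣p∣ x p (x∉p ∘ Vec.there)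

x∈p─q⇒x∉q : (p q : Subset n) {x : Fin n} → x ∈ p ─ q → x ∉ q
x∈p─q⇒x∉q (true ∷ p) (true ∷ q) () Vec.here
x∈p─q⇒x∉q (false ∷ p) (true ∷ q) () Vec.here
x∈p─q⇒x∉q (_ ∷ p) (_ ∷ q) (Vec.there x∈) (Vec.there x∈q) = x∈p─q⇒x∉q p q x∈ x∈q

∈-tabulate⁺ : {f : Fin n → Bool} {x : Fin n} → f x ≡ true → x ∈ tabulate f
∈-tabulate⁺ {f = f} {x} fx = lookup⇒[]= x _ (trans (lookup∘tabulate f x) fx)

∈-tabulate⁻ : {f : Fin n → Bool} {x : Fin n} → x ∈ tabulate f → f x ≡ true
∈-tabulate⁻ {f = f} {x} x∈ = trans (sym (lookup∘tabulate f x)) ([]=⇒lookup x∈)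


-- An injection serves two purposes: it picks `m` distinct vertices of `W`, and for `m = ∣ W ∣` it
-- enumerates `W`.
choose : ∀ m (W : Subset n) → m ≤ ∣ W ∣ →
         Σ (Fin m → Fin n) λ g → Injective _≡_ _≡_ g × (∀ i → g i ∈ W)
choose zero W _ = (λ ()) , (λ { {()} }) , λ ()
choose (suc m) (true ∷ W) (s≤s m≤) with g , inj , g∈W ← choose m W m≤ = g′ , inj′ , g′∈W
  where
  g′ : Fin (suc m) → Fin _
  g′ zero    = zero
  g′ (suc i) = suc (g i)
  inj′ : Injective _≡_ _≡_ g′
  inj′ {zero}  {zero}  _  = refl
  inj′ {suc i} {suc j} eq = cong suc (inj (Fin.suc-injective eq))
  g′∈W : ∀ i → g′ i ∈ true ∷ W
  g′∈W zero    = Vec.here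
  g′∈W (suc i) = Vec.there (g∈W i)
choose (suc m) (false ∷ W) m≤ with g , inj , g∈W ← choose (suc m) W m≤ =
  suc ∘ g , inj ∘ Fin.suc-injective , Vec.there ∘ g∈W

nonempty : (W : Subset n) → 0 < ∣ W ∣ → ∃ λ x → x ∈ W
nonempty W 0<W with g , _ , g∈W ← choose 1 W 0<W = g zero , g∈W zero

∈-image⁺ : (f : A → Fin n) {l : List A} {a : A} → a ∈ₗ l → f a ∈ image f l
∈-image⁺ f {a ∷ l} (here refl) = p⊆p∪q (image f l) (x∈⁅x⁆ (f a))
∈-image⁺ f {b ∷ l} (there a∈l) = q⊆p∪q ⁅ f b ⁆ (image f l) (∈-image⁺ f a∈l)

∈-image⁻ : (f : A → Fin n) (l : List A) {x : Fin n} → x ∈ image f l → ∃ λ a → a ∈ₗ l × x ≡ f a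
∈-image⁻ f [] x∈ = contradiction x∈ ∉⊥
∈-image⁻ f (a ∷ l) x∈ with x∈p∪q⁻ ⁅ f a ⁆ (image f l) x∈
... | inj₁ x∈a = a , here refl , x∈⁅y⁆⇒x≡y (f a) x∈a
... | inj₂ x∈l with b , b∈l , eq ← ∈-image⁻ f l x∈l = b , there b∈l , eq

∣image∣≤length : (f : A → Fin n) (l : List A) → ∣ image f l ∣ ≤ length l
∣image∣≤length {n = n} f [] = ≤-reflexive (∣⊥∣≡0 n)
∣image∣≤length f (a ∷ l) = ≤-trans (∣p∪q∣≤∣p∣+∣q∣ ⁅ f a ⁆ (image f l))
  (+-mono-≤ (≤-reflexive (∣⁅x⁆∣≡1 (f a))) (∣image∣≤length f l))

∣image∣≡length : {f : A → Fin n} → Injective _≡_ _≡_ f → {l : List A} → Unique l →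
                 ∣ image f l ∣ ≡ length l
∣image∣≡length {n = n} inj {[]} [] = ∣⊥∣≡0 n
∣image∣≡length {f = f} inj {a ∷ l} (a∉l ∷ u) =
  trans (x∉p⇒∣⁅x⁆∪p∣≡1+∣p∣ (f a) (image f l) fa∉) (cong suc (∣image∣≡length inj u))
  where
  fa∉ : f a ∉ image f l
  fa∉ fa∈ with b , b∈l , eq ← ∈-image⁻ f l fa∈ = All.lookup a∉l b∈l (inj eq)

image-map : (f : B → Fin n) (g : A → B) (l : List A) → image f (map g l) ≡ image (f ∘ g) l
image-map f g []      = refl
image-map f g (a ∷ l) = cong (⁅ f (g a) ⁆ ∪_) (image-map f g l)

image-∷ʳ : (f : A → Fin n) (l : List A) (a : A) → image f (l ++ a ∷ []) ≡ image f l ∪ ⁅ f a ⁆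
image-∷ʳ f []      a = ∪-comm ⁅ f a ⁆ ∅
image-∷ʳ f (b ∷ l) a =
  trans (cong (⁅ f b ⁆ ∪_) (image-∷ʳ f l a)) (sym (∪-assoc ⁅ f b ⁆ (image f l) ⁅ f a ⁆))

image-cong : {f g : A → Fin n} → f ≗ g → (l : List A) → image f l ≡ image g l
image-cong f≗g []      = refl
image-cong f≗g (a ∷ l) = cong₂ (λ x S → ⁅ x ⁆ ∪ S) (f≗g a) (image-cong f≗g l)

length-filterᵇ-tabulate : (p : A → Bool) (f : Fin n → A) →
                          length (filterᵇ p (List.tabulate f)) ≡ ∣ tabulate (p ∘ f) ∣
length-filterᵇ-tabulate {n = zero} p f = refl
length-filterᵇ-tabulate {n = suc n} p f with p (f zero)
... | true  = cong suc (length-filterᵇ-tabulate p (f ∘ suc))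
... | false = length-filterᵇ-tabulate p (f ∘ suc)

sum-indicator-tabulate : (p : A → Bool) (f : Fin n → A) →
  sum (map (λ a → if p a then 1 else 0) (List.tabulate f)) ≡ ∣ tabulate (p ∘ f) ∣
sum-indicator-tabulate {n = zero} p f = refl
sum-indicator-tabulate {n = suc n} p f with p (f zero)
... | true  = cong suc (sum-indicator-tabulate p (f ∘ suc))
... | false = sum-indicator-tabulate p (f ∘ suc)

members-unique : (X : Subset n) → Unique (members X)
members-unique {n} X = Unique.filter⁺ (T? ∘ lookup X) (Unique.allFin⁺ n)

length-members : (X : Subset n) → length (members X) ≡ ∣ X ∣
length-members X = trans (length-filterᵇ-tabulate (lookup X) id) (cong ∣_∣ (tabulate∘lookup X))

∈-members⁻ : (X : Subset n) {x : Fin n} → x ∈ₗ members X → x ∈ X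
∈-members⁻ {n} X {x} x∈ with lookup X x in eq | proj₂ (L.∈-filter⁻ (T? ∘ lookup X) {xs = allFin n} x∈)
... | true | _ = lookup⇒[]= x X eq

choose-subset : ∀ m (W : Subset n) → m ≤ ∣ W ∣ → ∃ λ X → ∣ X ∣ ≡ m × (∀ {x} → x ∈ X → x ∈ W)
choose-subset m W m≤ with g , inj , g∈W ← choose m W m≤ =
  image g (allFin m) ,
  trans (∣image∣≡length inj (Unique.allFin⁺ m)) (length-tabulate id) ,
  λ x∈ → let a , _ , eq = ∈-image⁻ g (allFin m) x∈ in subst (_∈ W) (sym eq) (g∈W a)

⟦_⟧ : {P : Fin n → Set} → Decidable P → Subset n
⟦ P? ⟧ = tabulate (does ∘ P?)

∈-⟦⟧⁺ : {P : Fin n → Set} (P? : Decidable P) {x : Fin n} → P x → x ∈ ⟦ P? ⟧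
∈-⟦⟧⁺ P? {x} px = ∈-tabulate⁺ (dec-true (P? x) px)

∈-⟦⟧⁻ : {P : Fin n → Set} (P? : Decidable P) {x : Fin n} → x ∈ ⟦ P? ⟧ → P x
∈-⟦⟧⁻ P? {x} x∈ with P? x | ∈-tabulate⁻ {f = does ∘ P?} x∈
... | yes px | _ = px

-- Induction on the number of colours: either the top colour occurs at least `suc q` times, or
-- deleting its class costs at most `q` elements of `W`. Colours are natural numbers, so that
-- deleting the top one needs no relabelling.
pigeonhole : ∀ r q (c : Fin n → ℕ) (W : Subset n) → (∀ {x} → x ∈ W → c x < r) →
             r * q < ∣ W ∣ → ∃ λ i → i < r × (∃ λ X → ∣ X ∣ ≡ suc q × (∀ {x} → x ∈ X → c x ≡ i))
pigeonhole zero q c W c< 0<W with x , x∈W ← nonempty W 0<W with () ← c< x∈W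
pigeonhole {n} (suc r) q c W c< rq<W with suc q ≤? ∣ ⟦ (λ x → c x ≟ r) ⟧ ∣
... | yes q<C with X , ∣X∣ , X⊆ ← choose-subset (suc q) _ q<C =
  r , ≤-refl , X , ∣X∣ , λ x∈ → ∈-⟦⟧⁻ (λ x → c x ≟ r) (X⊆ x∈)
... | no q≮C = let i , i<r , rest = pigeonhole r q c (W ─ C) c<r rq<W─C in i , m<n⇒m<1+n i<r , rest
  where
  C : Subset n
  C = ⟦ (λ x → c x ≟ r) ⟧
  c<r : ∀ {x} → x ∈ W ─ C → c x < r
  c<r x∈ = ≤∧≢⇒< (s≤s⁻¹ (c< (p─q⊆p W C x∈))) (x∈p─q⇒x∉q W C x∈ ∘ ∈-⟦⟧⁺ (λ x → c x ≟ r))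
  rq<W─C : r * q < ∣ W ─ C ∣
  rq<W─C = +-cancelˡ-< q (r * q) ∣ W ─ C ∣ (begin-strict
    q + r * q             <⟨ rq<W ⟩
    ∣ W ∣                 ≤⟨ ∣p∣≤∣p─q∣+∣q∣ W C ⟩
    ∣ W ─ C ∣ + ∣ C ∣     ≤⟨ +-monoʳ-≤ ∣ W ─ C ∣ (s≤s⁻¹ (≰⇒> q≮C)) ⟩
    ∣ W ─ C ∣ + q         ≡⟨ +-comm ∣ W ─ C ∣ q ⟩
    q + ∣ W ─ C ∣         ∎)
    where open ≤-Reasoning

-- Non-colourability

-- The colour `i` shared by `X` is missing from the copy of `G` attached to `X`. There `punchOut`
-- deletes it, leaving `r` colours, and `punchIn` turns a monochromatic edge for `c′` back into one
-- for `c`.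
Colourable-step : ∀ κ r (G : AbsGraph) → Colourable (suc r) (step (suc (suc κ)) (suc r) G) → Colourable r G
Colourable-step κ r G (c , proper) = c′ , proper′
  where
  k s : ℕ
  k = suc (suc κ)
  s = suc r * κ + 1

  -- Here `s` exceeds `suc r * κ` by exactly one, which is what forces `suc κ`, that is `k - 1`,
  -- vertices of one colour.
  majority : ∃ λ i → i < suc r × (∃ λ X → ∣ X ∣ ≡ suc κ × (∀ {x} → x ∈ X → toℕ (c (inj₁ x)) ≡ i))
  majority = pigeonhole (suc r) κ (toℕ ∘ c ∘ inj₁) (⊤ {s}) (λ {x} _ → Fin.toℕ<n (c (inj₁ x)))
    (≤-reflexive (trans (+-comm 1 (suc r * κ)) (sym (∣⊤∣≡n s))))

  X : KSub k s
  X = let _ , _ , Y , ∣Y∣ , _ = majority in Y , ∣Y∣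

  i : Fin (suc r)
  i = let _ , i< , _ = majority in fromℕ< i<

  X-mono : ∀ {x} → x ∈ proj₁ X → c (inj₁ x) ≡ i
  X-mono x∈ = let _ , i< , _ , _ , mono = majority in
    Fin.toℕ-injective (trans (mono x∈) (sym (Fin.toℕ-fromℕ< i<)))

  i≢ : ∀ v → i ≢ c (inj₂ (X , v))
  i≢ v eq = proper (inj₁ (X , v)) (i , mono)
    where
    mono : ∀ u → u ∈ₗ map inj₁ (members (proj₁ X)) ++ inj₂ (X , v) ∷ [] → c u ≡ i
    mono u u∈ with L.∈-++⁻ (map inj₁ (members (proj₁ X))) u∈
    ... | inj₂ (here refl) = sym eq
    ... | inj₁ u∈X with x , x∈ , refl ← L.∈-map⁻ inj₁ u∈X = X-mono (∈-members⁻ (proj₁ X) x∈)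

  c′ : V G → Fin r
  c′ v = punchOut (i≢ v)

  proper′ : ∀ e → ¬ (∃ λ j → ∀ v → v ∈ₗ edge G e → c′ v ≡ j)
  proper′ e (j , mono) = proper (inj₂ (X , e)) (punchIn i j , mono′)
    where
    mono′ : ∀ u → u ∈ₗ map (λ w → inj₂ (X , w)) (edge G e) → c u ≡ punchIn i j
    mono′ u u∈ with v , v∈ , refl ← L.∈-map⁻ _ u∈ =
      trans (sym (Fin.punchIn-punchOut (i≢ v))) (cong (punchIn i) (mono v v∈))

Fsuc-not-colourable : ∀ κ i → ¬ Colourable (suc i) (Fsuc (suc (suc κ)) i)
Fsuc-not-colourable κ zero (c , proper) = proper _ (zero , λ v _ → Fin1-trivial (c v))
  where
  Fin1-trivial : (x : Fin 1) → x ≡ zero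
  Fin1-trivial zero = refl
Fsuc-not-colourable κ (suc i) col =
  Fsuc-not-colourable κ i (Colourable-step κ (suc i) (Fsuc (suc (suc κ)) i) col)

-- Embedding F^k_r in hosts of large codegree

-- The set whose size `codeg` computes as a sum of indicators. It excludes `S`, so the complement
-- that is bounded by `t` below contains `S` along with the genuine non-neighbours, and a vertex
-- avoiding that complement is automatically outside `S`.
nbrs : ∀ {k} → KGraph k n → Subset n → Subset n
nbrs H S = tabulate λ v → not (lookup S v) ∧ E H (S ∪ ⁅ v ⁆)

codeg≡∣nbrs∣ : ∀ {k} (H : KGraph k n) S → codeg H S ≡ ∣ nbrs H S ∣
codeg≡∣nbrs∣ H S = sum-indicator-tabulate (λ v → not (lookup S v) ∧ E H (S ∪ ⁅ v ⁆)) id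

nbrs⇒IsEdge : ∀ {κ} (H : KGraph (suc κ) n) S {v} → ∣ S ∣ ≡ κ → v ∈ nbrs H S → IsEdge H (S ∪ ⁅ v ⁆)
nbrs⇒IsEdge H S {v} ∣S∣ v∈ with lookup S v in eq | ∈-tabulate⁻ {f = λ u → not (lookup S u) ∧ E H (S ∪ ⁅ u ⁆)} v∈
... | false | edge =
  trans (cong ∣_∣ (∪-comm S ⁅ v ⁆)) (trans (x∉p⇒∣⁅x⁆∪p∣≡1+∣p∣ v S v∉S) (cong suc ∣S∣)) , edge
  where
  v∉S : v ∉ S
  v∉S v∈S with () ← trans (sym eq) ([]=⇒lookup v∈S)

-- Finiteness of the vertex and edge types of F^k_r.

record Finite (A : Set) : Set where
  field
    elems    : List A
    complete : ∀ a → a ∈ₗ elems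
    _≡?_     : DecidableEquality A
open Finite

Fin-finite : ∀ n → Finite (Fin n)
Fin-finite n = record { elems = allFin n ; complete = L.∈-allFin ; _≡?_ = Fin._≟_ }

⊎-finite : Finite A → Finite B → Finite (A ⊎ B)
⊎-finite finA finB = record
  { elems    = map inj₁ (elems finA) ++ map inj₂ (elems finB)
  ; complete = λ where
      (inj₁ a) → L.∈-++⁺ˡ (L.∈-map⁺ inj₁ (complete finA a))
      (inj₂ b) → L.∈-++⁺ʳ _ (L.∈-map⁺ inj₂ (complete finB b))
  ; _≡?_     = Sum.≡-dec (_≡?_ finA) (_≡?_ finB)
  }

×-finite : Finite A → Finite B → Finite (A × B)
×-finite finA finB = record
  { elems    = List.cartesianProduct (elems finA) (elems finB)
  ; complete = λ (a , b) → L.∈-cartesianProduct⁺ (complete finA a) (complete finB b)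
  ; _≡?_     = Product.≡-dec (_≡?_ finA) (_≡?_ finB)
  }

Subset-finite : ∀ n → Finite (Subset n)
Subset-finite n = record { elems = subsets n ; complete = ∈-subsets ; _≡?_ = Vec.≡-dec Bool._≟_ }
  where
  subsets : ∀ n → List (Subset n)
  subsets zero    = [] ∷ []
  subsets (suc n) = List.cartesianProductWith _∷_ (true ∷ false ∷ []) (subsets n)
  ∈-subsets : ∀ {n} (X : Subset n) → X ∈ₗ subsets n
  ∈-subsets []          = here refl
  ∈-subsets (true ∷ X)  = L.∈-cartesianProductWith⁺ _∷_ {xs = true ∷ false ∷ []} (here refl) (∈-subsets X)
  ∈-subsets (false ∷ X) = L.∈-cartesianProductWith⁺ _∷_ {xs = true ∷ false ∷ []} (there (here refl)) (∈-subsets X)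

-- Irrelevance of `P` lets the proof found by `P?` stand for any given one, and makes equality of
-- pairs a matter of first components.
Σ-finite : {P : A → Set} → Decidable P → (∀ {a} (p q : P a) → p ≡ q) → Finite A → Finite (Σ A P)
Σ-finite {A} {P} P? irr finA = record
  { elems    = restrict (elems finA)
  ; complete = λ (a , p) → ∈-restrict p (complete finA a)
  ; _≡?_     = Product.≡-dec (_≡?_ finA) (λ p q → yes (irr p q))
  }
  where
  restrict : List A → List (Σ A P)
  restrict [] = []
  restrict (a ∷ l) with P? a
  ... | yes p = (a , p) ∷ restrict l
  ... | no  _ = restrict l
  ∈-restrict : ∀ {a} (p : P a) {l} → a ∈ₗ l → (a , p) ∈ₗ restrict l
  ∈-restrict {a} p (here refl) with P? a
  ... | yes q = here (cong (a ,_) (irr p q))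
  ... | no ¬p = contradiction p ¬p
  ∈-restrict p {b ∷ l} (there a∈) with P? b
  ... | yes _ = there (∈-restrict p a∈)
  ... | no  _ = ∈-restrict p a∈

KSub-finite : ∀ k s → Finite (KSub k s)
KSub-finite k s = Σ-finite (λ X → ∣ X ∣ ≟ k ∸ 1) ≡-irrelevant (Subset-finite s)

Fsuc-V-finite : ∀ k i → Finite (V (Fsuc k i))
Fsuc-V-finite k zero    = Fin-finite k
Fsuc-V-finite k (suc i) = ⊎-finite (Fin-finite _) (×-finite (KSub-finite k _) (Fsuc-V-finite k i))

Fsuc-Ix-finite : ∀ k i → Finite (Ix (Fsuc k i))
Fsuc-Ix-finite k zero    = record { elems = tt ∷ [] ; complete = λ _ → here refl ; _≡?_ = λ _ _ → yes refl }
Fsuc-Ix-finite k (suc i) =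
  ⊎-finite (×-finite (KSub-finite k _) (Fsuc-V-finite k i)) (×-finite (KSub-finite k _) (Fsuc-Ix-finite k i))

-- Greedy embedding inside a prescribed vertex set.

EmbedsIn : ∀ {k} → KGraph k n → AbsGraph → Subset n → Set
EmbedsIn {n} H G W = Σ (V G → Fin n) λ f →
  Injective _≡_ _≡_ f × (∀ v → f v ∈ W) × (∀ e → IsEdge H (image f (edge G e)))

-- Any `κ` vertices `X` of `W` will do: fewer than `∣ W ∣` vertices lie outside `nbrs H X`, so `W`
-- contains a neighbour `v` that completes an edge.
embed-edge : ∀ {κ} (H : KGraph (suc κ) n) {t} W → (∀ S → ∣ S ∣ ≡ κ → ∣ ∁ (nbrs H S) ∣ ≤ t) →
             t + suc κ ≤ ∣ W ∣ → EmbedsIn H (singleEdge (suc κ)) W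
embed-edge {n} {κ} H {t} W few t+k≤W
  with g , g-inj , g∈W ← choose κ W (≤-trans (n≤1+n κ) (m+n≤o⇒n≤o t t+k≤W)) =
  f , f-inj , f∈W , λ _ → subst (IsEdge H) X∪v≡ (nbrs⇒IsEdge H X ∣X∣ v∈N)
  where
  X : Subset n
  X = image g (allFin κ)

  ∣X∣ : ∣ X ∣ ≡ κ
  ∣X∣ = trans (∣image∣≡length g-inj (Unique.allFin⁺ κ)) (length-tabulate id)

  0<∣W─∁N∣ : 0 < ∣ W ─ ∁ (nbrs H X) ∣
  0<∣W─∁N∣ = +-cancelʳ-< ∣ ∁ (nbrs H X) ∣ 0 _ (begin-strict
    ∣ ∁ (nbrs H X) ∣                          ≤⟨ few X ∣X∣ ⟩
    t                                         <⟨ m<m+n t (s≤s z≤n) ⟩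
    t + suc κ                                 ≤⟨ t+k≤W ⟩
    ∣ W ∣                                     ≤⟨ ∣p∣≤∣p─q∣+∣q∣ W (∁ (nbrs H X)) ⟩
    ∣ W ─ ∁ (nbrs H X) ∣ + ∣ ∁ (nbrs H X) ∣   ∎)
    where open ≤-Reasoning

  v-choice : ∃ λ v → v ∈ W ─ ∁ (nbrs H X)
  v-choice = nonempty _ 0<∣W─∁N∣

  v : Fin n
  v = proj₁ v-choice

  v∈N : v ∈ nbrs H X
  v∈N = x∉∁p⇒x∈p (x∈p─q⇒x∉q W _ (proj₂ v-choice))

  v∉X : v ∉ X
  v∉X v∈X with lookup X v | []=⇒lookup v∈X | ∈-tabulate⁻ {f = λ u → not (lookup X u) ∧ E H (X ∪ ⁅ u ⁆)} v∈N
  ... | true | _ | ()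

  -- With `v` at index zero, the image of `allFin (suc κ)` unfolds to `⁅ v ⁆` joined with the image
  -- of `g`.
  f : Fin (suc κ) → Fin n
  f zero    = v
  f (suc i) = g i

  f-inj : Injective _≡_ _≡_ f
  f-inj {zero}  {zero}  _  = refl
  f-inj {zero}  {suc j} eq = contradiction (subst (_∈ X) (sym eq) (∈-image⁺ g (L.∈-allFin j))) v∉X
  f-inj {suc i} {zero}  eq = contradiction (subst (_∈ X) eq (∈-image⁺ g (L.∈-allFin i))) v∉X
  f-inj {suc i} {suc j} eq = cong suc (g-inj eq)

  f∈W : ∀ i → f i ∈ W
  f∈W zero    = p─q⊆p W _ (proj₂ v-choice)
  f∈W (suc i) = g∈W i

  X∪v≡ : X ∪ ⁅ v ⁆ ≡ image f (allFin (suc κ))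
  X∪v≡ = trans (∪-comm X ⁅ v ⁆) (cong (⁅ v ⁆ ∪_)
    (trans (sym (image-map f suc (allFin κ))) (cong (image f) (map-tabulate id suc))))

module _ {k : ℕ} (H : KGraph k n) (G : AbsGraph) (finV : Finite (V G)) {I : Set} (_≟ᴵ_ : DecidableEquality I)
         (N : I → Subset n) (b : ℕ)
         (embed : (x : I) (U : Subset n) → ∣ U ∣ ≤ b → EmbedsIn H G (N x ─ U)) where

  -- The copies are placed one after another, with `U` collecting the vertices already used. A copy
  -- adds at most `length (elems finV)` vertices to `U`, so the hypothesis keeps `U` within the
  -- budget `b` up to the last copy.
  disjoint-copies : (xs : List I) (U : Subset n) → ∣ U ∣ + length xs * length (elems finV) ≤ b →
    Σ (I → V G → Fin n) λ h →
      (∀ {x} → x ∈ₗ xs → Injective _≡_ _≡_ (h x) × (∀ w → h x w ∈ N x ─ U) ×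
                         (∀ e → IsEdge H (image (h x) (edge G e)))) ×
      (∀ {x y} → x ∈ₗ xs → y ∈ₗ xs → ∀ w w′ → h x w ≡ h y w′ → x ≡ y)
  disjoint-copies [] U _ =
    -- A default: `h` must be total on `I`, while its properties are claimed only for listed
    -- indices.
    (λ x → proj₁ (embed x ∅ (subst (_≤ b) (sym (∣⊥∣≡0 n)) z≤n))) , (λ ()) , λ ()
  disjoint-copies (x ∷ xs) U U+≤b
    with f , f-inj , f∈ , f-edge ← embed x U (m+n≤o⇒m≤o ∣ U ∣ U+≤b) =
    h′ , good′ , disj′
    where
    open ≤-Reasoning
    vs : List (V G)
    vs = elems finV

    U′+≤b : ∣ U ∪ image f vs ∣ + length xs * length vs ≤ b
    U′+≤b = begin
      ∣ U ∪ image f vs ∣ + length xs * length vs          ≤⟨ +-monoˡ-≤ _ (∣p∪q∣≤∣p∣+∣q∣ U (image f vs)) ⟩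
      ∣ U ∣ + ∣ image f vs ∣ + length xs * length vs      ≤⟨ +-monoˡ-≤ _ (+-monoʳ-≤ ∣ U ∣ (∣image∣≤length f vs)) ⟩
      ∣ U ∣ + length vs + length xs * length vs           ≡⟨ +-assoc ∣ U ∣ _ _ ⟩
      ∣ U ∣ + (length vs + length xs * length vs)         ≤⟨ U+≤b ⟩
      b                                                   ∎

    h = proj₁ (disjoint-copies xs (U ∪ image f vs) U′+≤b)
    good = proj₁ (proj₂ (disjoint-copies xs (U ∪ image f vs) U′+≤b))
    disj = proj₂ (proj₂ (disjoint-copies xs (U ∪ image f vs) U′+≤b))

    -- Repeated entries of `xs` are harmless: the copy chosen for the head overrides any later
    -- choice for the same index.
    h′ : I → V G → Fin n
    h′ y with y ≟ᴵ x
    ... | yes _ = f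
    ... | no  _ = h y

    tail : ∀ {y} → y ≢ x → y ∈ₗ x ∷ xs → y ∈ₗ xs
    tail y≢x (here y≡x) = contradiction y≡x y≢x
    tail y≢x (there y∈) = y∈

    good′ : ∀ {y} → y ∈ₗ x ∷ xs → Injective _≡_ _≡_ (h′ y) × (∀ w → h′ y w ∈ N y ─ U) ×
                                  (∀ e → IsEdge H (image (h′ y) (edge G e)))
    good′ {y} y∈ with y ≟ᴵ x
    ... | yes refl = f-inj , f∈ , f-edge
    ... | no y≢x with h-inj , h∈ , h-edge ← good (tail y≢x y∈) =
      h-inj ,
      (λ w → x∈p∧x∉q⇒x∈p─q (p─q⊆p (N y) _ (h∈ w)) (x∈p─q⇒x∉q (N y) _ (h∈ w) ∘ p⊆p∪q _)) ,
      h-edge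

    -- Every later copy avoids the image of `f`, which was added to the used set before the
    -- recursive call.
    f≢h : ∀ {y} → y ∈ₗ xs → ∀ w w′ → f w ≢ h y w′
    f≢h {y} y∈ w w′ eq with _ , h∈ , _ ← good y∈ =
      x∈p─q⇒x∉q (N y) _ (h∈ w′)
        (q⊆p∪q U _ (subst (_∈ image f vs) eq (∈-image⁺ f (complete finV w))))

    disj′ : ∀ {y z} → y ∈ₗ x ∷ xs → z ∈ₗ x ∷ xs → ∀ w w′ → h′ y w ≡ h′ z w′ → y ≡ z
    disj′ {y} {z} y∈ z∈ w w′ eq with y ≟ᴵ x | z ≟ᴵ x
    ... | yes refl | yes refl = refl
    ... | yes refl | no z≢x   = contradiction eq (f≢h (tail z≢x z∈) w w′)
    ... | no y≢x   | yes refl = contradiction (sym eq) (f≢h (tail y≢x y∈) w′ w)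
    ... | no y≢x   | no z≢x   = disj (tail y≢x y∈) (tail z≢x z∈) w w′ eq

embed-step : ∀ {κ} r (H : KGraph (suc κ) n) (G : AbsGraph) (finV : Finite (V G)) {t} C W →
  (∀ S → ∣ S ∣ ≡ κ → ∣ ∁ (nbrs H S) ∣ ≤ t) →
  (∀ W′ → r * t + C ≤ ∣ W′ ∣ → EmbedsIn H G W′) →
  let s = suc r * (κ ∸ 1) + 1
      b = s + length (elems (KSub-finite (suc κ) s)) * length (elems finV) in
  suc r * t + (b + C) ≤ ∣ W ∣ → EmbedsIn H (step (suc κ) (suc r) G) W
embed-step {n} {κ} r H G finV {t} C W few embed big
  with g , g-inj , g∈W ← choose (suc r * (κ ∸ 1) + 1) W
         (m+n≤o⇒m≤o _ (m+n≤o⇒m≤o _ (m+n≤o⇒n≤o (suc r * t) big))) = result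
  where
  s b : ℕ
  s = suc r * (κ ∸ 1) + 1
  Xs : List (KSub (suc κ) s)
  Xs = elems (KSub-finite (suc κ) s)
  b = s + length Xs * length (elems finV)

  gX : KSub (suc κ) s → Subset n
  gX (X , _) = image g (members X)

  ∣gX∣ : ∀ X → ∣ gX X ∣ ≡ κ
  ∣gX∣ (X , ∣X∣) = trans (∣image∣≡length g-inj (members-unique X)) (trans (length-members X) ∣X∣)

  -- The neighbours of `gX X` within `W`, written as a difference so that the same size estimate
  -- handles this removal and that of the used vertices.
  N : KSub (suc κ) s → Subset n
  N X = W ─ ∁ (nbrs H (gX X))

  embed-N : ∀ X U → ∣ U ∣ ≤ b → EmbedsIn H G (N X ─ U)
  embed-N X U U≤b = embed (N X ─ U) (+-cancelˡ-≤ (t + b) _ _ (begin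
    t + b + (r * t + C)                        ≡⟨ +-assoc t b _ ⟩
    t + (b + (r * t + C))                      ≡⟨ cong (t +_) (sym (+-assoc b (r * t) C)) ⟩
    t + (b + r * t + C)                        ≡⟨ cong (λ x → t + (x + C)) (+-comm b (r * t)) ⟩
    t + (r * t + b + C)                        ≡⟨ cong (t +_) (+-assoc (r * t) b C) ⟩
    t + (r * t + (b + C))                      ≡⟨ sym (+-assoc t (r * t) (b + C)) ⟩
    suc r * t + (b + C)                        ≤⟨ big ⟩
    ∣ W ∣                                      ≤⟨ ∣p∣≤∣p─q∣+∣q∣ W _ ⟩
    ∣ N X ∣ + ∣ ∁ (nbrs H (gX X)) ∣            ≤⟨ +-monoʳ-≤ ∣ N X ∣ (few (gX X) (∣gX∣ X)) ⟩
    ∣ N X ∣ + t                                ≤⟨ +-monoˡ-≤ t (∣p∣≤∣p─q∣+∣q∣ (N X) U) ⟩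
    ∣ N X ─ U ∣ + ∣ U ∣ + t                    ≤⟨ +-monoˡ-≤ t (+-monoʳ-≤ ∣ N X ─ U ∣ U≤b) ⟩
    ∣ N X ─ U ∣ + b + t                        ≡⟨ +-assoc ∣ N X ─ U ∣ b t ⟩
    ∣ N X ─ U ∣ + (b + t)                      ≡⟨ +-comm ∣ N X ─ U ∣ (b + t) ⟩
    b + t + ∣ N X ─ U ∣                        ≡⟨ cong (_+ ∣ N X ─ U ∣) (+-comm b t) ⟩
    t + b + ∣ N X ─ U ∣                        ∎))
    where open ≤-Reasoning

  -- The core itself is the initial used set; this accounts for the summand `s` of `b`.
  U₀ : Subset n
  U₀ = image g (allFin s)

  result : EmbedsIn H (step (suc κ) (suc r) G) W
  result with h , good , disj ← disjoint-copies H G finV (_≡?_ (KSub-finite (suc κ) s)) N b embed-N Xs U₀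
                (+-monoˡ-≤ _ (≤-trans (∣image∣≤length g (allFin s)) (≤-reflexive (length-tabulate id)))) =
    f , f-inj , f∈W , f-edge
    where
    Xs-complete : ∀ X → X ∈ₗ Xs
    Xs-complete = complete (KSub-finite (suc κ) s)

    f : Fin s ⊎ (KSub (suc κ) s × V G) → Fin n
    f (inj₁ i)       = g i
    f (inj₂ (X , w)) = h X w

    h∈ : ∀ X w → h X w ∈ N X ─ U₀
    h∈ X = proj₁ (proj₂ (good (Xs-complete X)))

    g≢h : ∀ i X w → g i ≢ h X w
    g≢h i X w eq = x∈p─q⇒x∉q (N X) U₀ (h∈ X w) (subst (_∈ U₀) eq (∈-image⁺ g (L.∈-allFin i)))

    f-inj : Injective _≡_ _≡_ f
    f-inj {inj₁ i} {inj₁ j} eq = cong inj₁ (g-inj eq)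
    f-inj {inj₁ i} {inj₂ (X , w)} eq = contradiction eq (g≢h i X w)
    f-inj {inj₂ (X , w)} {inj₁ i} eq = contradiction (sym eq) (g≢h i X w)
    f-inj {inj₂ (X , w)} {inj₂ (Y , w′)} eq with refl ← disj (Xs-complete X) (Xs-complete Y) w w′ eq =
      cong (λ u → inj₂ (X , u)) (proj₁ (good (Xs-complete X)) eq)

    f∈W : ∀ v → f v ∈ W
    f∈W (inj₁ i)       = g∈W i
    f∈W (inj₂ (X , w)) = p─q⊆p W _ (p─q⊆p (N X) U₀ (h∈ X w))

    f-edge : ∀ e → IsEdge H (image f (edge (step (suc κ) (suc r) G) e))
    f-edge (inj₁ (X , w)) = subst (IsEdge H)
      (sym (trans (image-∷ʳ f (map inj₁ (members (proj₁ X))) (inj₂ (X , w)))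
                  (cong (_∪ ⁅ h X w ⁆) (image-map f inj₁ (members (proj₁ X))))))
      (nbrs⇒IsEdge H (gX X) (∣gX∣ X) (x∉∁p⇒x∈p (x∈p─q⇒x∉q W _ (p─q⊆p (N X) U₀ (h∈ X w)))))
    f-edge (inj₂ (X , e)) = subst (IsEdge H) (sym (image-map f (λ w → inj₂ (X , w)) (edge G e)))
      (proj₂ (proj₂ (good (Xs-complete X))) e)

-- The quantifier order is essential: `C` depends only on `κ` and `i`, not on `n`, `H`, `t` or `W`,
-- and therefore disappears after division by `n`. Each induction step adds the constant `b` of
-- `embed-step`.
embed-Fsuc : ∀ κ i → ∃ λ C → ∀ {n} (H : KGraph (suc κ) n) {t} W →
  (∀ S → ∣ S ∣ ≡ κ → ∣ ∁ (nbrs H S) ∣ ≤ t) →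
  suc i * t + C ≤ ∣ W ∣ → EmbedsIn H (Fsuc (suc κ) i) W
embed-Fsuc κ zero = suc κ , λ H {t} W few big →
  embed-edge H W few (subst (λ x → x + suc κ ≤ ∣ W ∣) (*-identityˡ t) big)
embed-Fsuc κ (suc i) with C , embed ← embed-Fsuc κ i =
  _ , λ H W few → embed-step (suc i) H (Fsuc (suc κ) i) (Fsuc-V-finite (suc κ) i) C W few
        (λ W′ → embed H W′ few)

-- Existence of co-ex(n, F)

∀-dec : Finite A → {P : A → Set} → Decidable P → Dec (∀ a → P a)
∀-dec finA P? =
  map′ (λ all a → All.lookup all (complete finA a)) (λ p → All.universal p _) (All.all? P? (elems finA))

∃-dec : {P : A → Set} → Decidable P → (l : List A) → Dec (∃ λ a → a ∈ₗ l × P a)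
∃-dec P? l = map′ L.find (λ (a , a∈ , pa) → L.lose a∈ pa) (any? P? l)

module _ (finA : Finite A) (b₀ : B) (bs : List B) where

  private
    functionsOn : List A → List (A → B)
    functionsOn []      = (λ _ → b₀) ∷ []
    functionsOn (a ∷ l) =
      List.cartesianProductWith (λ b g x → if does (_≡?_ finA x a) then b else g x) bs (functionsOn l)

    -- Induction on the list, overwriting the value at its head. Agreement is claimed only on `l`;
    -- elsewhere the listed functions take the default `b₀`.
    functionsOn-complete : (∀ b → b ∈ₗ bs) → (f : A → B) (l : List A) →
                           ∃ λ g → g ∈ₗ functionsOn l × (∀ {x} → x ∈ₗ l → g x ≡ f x)
    functionsOn-complete all f [] = _ , here refl , λ ()
    functionsOn-complete all f (a ∷ l) with g , g∈ , g≗f ← functionsOn-complete all f l =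
      g′ , L.∈-cartesianProductWith⁺ _ (all (f a)) g∈ , g′≗f
      where
      g′ : A → B
      g′ x = if does (_≡?_ finA x a) then f a else g x
      g′≗f : ∀ {x} → x ∈ₗ a ∷ l → g′ x ≡ f x
      g′≗f {x} x∈ with _≡?_ finA x a
      g′≗f {x} x∈          | yes refl = refl
      g′≗f {x} (here x≡a)  | no x≢a   = contradiction x≡a x≢a
      g′≗f {x} (there x∈l) | no _     = g≗f x∈l

  functions : List (A → B)
  functions = functionsOn (elems finA)

  -- Without function extensionality, functions can only be listed up to pointwise equality.
  functions-complete : (∀ b → b ∈ₗ bs) → (f : A → B) → ∃ λ g → g ∈ₗ functions × g ≗ f
  functions-complete all f with g , g∈ , g≗f ← functionsOn-complete all f (elems finA) =
    g , g∈ , λ x → g≗f (complete finA x)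

IsEmbedding : ∀ {k} → KGraph k n → (G : AbsGraph) → (V G → Fin n) → Set
IsEmbedding H G f = Injective _≡_ _≡_ f × (∀ e → IsEdge H (image f (edge G e)))

-- Exhaustive search. The host has `suc n` vertices so that `zero` can be the default value for
-- `functions`; being an embedding respects pointwise equality, so the listed maps suffice.
contains? : ∀ {k} (H : KGraph k (suc n)) (G : AbsGraph) → Finite (V G) → Finite (Ix G) → Dec (Contains H G)
contains? {n} {k} H G finV finIx =
  map′ (λ (f , _ , emb) → f , emb) back (∃-dec isEmbedding? (functions finV zero (allFin (suc n))))
  where
  isEmbedding? : Decidable (IsEmbedding H G)
  isEmbedding? f =
    map′ (λ inj {x} {y} → inj x y) (λ inj x y → inj {x} {y})
         (∀-dec finV λ x → ∀-dec finV λ y → f x Fin.≟ f y →-dec _≡?_ finV x y)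
    ×-dec ∀-dec finIx (λ e → ∣ image f (edge G e) ∣ ≟ k ×-dec E H (image f (edge G e)) Bool.≟ true)
  back : Contains H G → ∃ λ f → f ∈ₗ functions finV zero (allFin (suc n)) × IsEmbedding H G f
  back (f , f-inj , f-edge) with g , g∈ , g≗f ← functions-complete finV zero (allFin (suc n)) L.∈-allFin f =
    g , g∈ , (λ {x} {y} eq → f-inj (trans (sym (g≗f x)) (trans eq (g≗f y)))) ,
    λ e → subst (IsEdge H) (sym (image-cong g≗f (edge G e))) (f-edge e)

codeg-cong : ∀ {k} {H H′ : KGraph k n} → E H ≗ E H′ → ∀ S → codeg H S ≡ codeg H′ S
codeg-cong {n} E≗ S =
  cong sum (map-cong (λ v → cong (λ x → if not (lookup S v) ∧ x then 1 else 0) (E≗ (S ∪ ⁅ v ⁆))) (allFin n))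

Contains-cong : ∀ {k} {H H′ : KGraph k n} {G} → E H ≗ E H′ → Contains H G → Contains H′ G
Contains-cong E≗ (f , inj , edges) =
  f , inj , λ e → proj₁ (edges e) , trans (sym (E≗ _)) (proj₂ (edges e))

-- The bound on `k ∸ 1` provides a first `(k-1)`-set, without which there is nothing to minimise
-- over.
min-codegree-exists : ∀ {k} (H : KGraph k n) → k ∸ 1 ≤ n → ∃ (MinCodeg H)
min-codegree-exists {n} {k} H k-1≤n =
  codeg H (proj₁ S) ,
  (λ X ∣X∣ → All.lookup (f[argmin]≤f[xs] S₀ (elems finK)) (complete finK (X , ∣X∣))) ,
  proj₁ S , proj₂ S , refl
  where
  finK : Finite (KSub k n)
  finK = KSub-finite k n
  S₀ : KSub k n
  S₀ = let X , ∣X∣ , _ = choose-subset (k ∸ 1) ⊤ (≤-trans k-1≤n (≤-reflexive (sym (∣⊤∣≡n n)))) in X , ∣X∣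
  S : KSub k n
  S = argmin (codeg H ∘ proj₁) S₀ (elems finK)

-- Compare at the set where `H′` attains its minimum. This transfers a minimum codegree from an
-- arbitrary host to its pointwise equal representative in a list.
MinCodeg-mono : ∀ {k c c′} {H H′ : KGraph k n} → E H ≗ E H′ → MinCodeg H c → MinCodeg H′ c′ → c ≤ c′
MinCodeg-mono {c = c} {c′} {H} {H′} E≗ (c≤ , _) (_ , S , ∣S∣ , codeg≡c′) = begin
  c            ≤⟨ c≤ S ∣S∣ ⟩
  codeg H S    ≡⟨ codeg-cong {H = H} {H′} E≗ S ⟩
  codeg H′ S   ≡⟨ codeg≡c′ ⟩
  c′           ∎
  where open ≤-Reasoning

module _ {k : ℕ} (G : AbsGraph) (free? : (H : KGraph k n) → Dec (¬ Contains H G))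
         (hosts : List (KGraph k n))
         (hosts-complete : (H : KGraph k n) → Σ (KGraph k n) λ H′ → H′ ∈ₗ hosts × (∀ S → E H S ≡ E H′ S))
         (δ : KGraph k n → ℕ) (δ-min : (H : KGraph k n) → MinCodeg H (δ H)) where

  -- Maximise `δ` over the `G`-free hosts in the list, starting from the given free host, so that
  -- the maximum ranges over a nonempty family.
  coex-exists-from : (H : KGraph k n) → ¬ Contains H G → ∃ (IsCoex k n G)
  coex-exists-from H₀ H₀-free = δ best , (best , best-free , δ-min best) , maximal
    where
    best : KGraph k n
    best = argmax δ H₀ (filter free? hosts)
    best-free : ¬ Contains best G
    best-free = argmax-all δ {P = λ H → ¬ Contains H G} H₀-free (All.all-filter free? hosts)
    maximal : ∀ H c → ¬ Contains H G → MinCodeg H c → c ≤ δ best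
    maximal H c free min =
      let H′ , H′∈ , E≗ = hosts-complete H in
      ≤-trans (MinCodeg-mono {H = H} {H′} E≗ min (δ-min H′))
        (All.lookup (f[xs]≤f[argmax] {f = δ} H₀ (filter free? hosts))
          (L.∈-filter⁺ free? H′∈ (free ∘ Contains-cong {H = H′} {H} {G} (sym ∘ E≗))))

coex-exists : ∀ {k} (G : AbsGraph) → Finite (V G) → Finite (Ix G) → k ∸ 1 ≤ suc n →
              (H : KGraph k (suc n)) → ¬ Contains H G → ∃ (IsCoex k (suc n) G)
coex-exists {n} {k} G finV finIx k-1≤n =
  coex-exists-from G (λ H → ¬? (contains? H G finV finIx)) (map fromE subsetFunctions) hosts-complete
    (λ H → proj₁ (min-codegree-exists H k-1≤n)) (λ H → proj₂ (min-codegree-exists H k-1≤n))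
  where
  fromE : (Subset (suc n) → Bool) → KGraph k (suc n)
  fromE e = record { E = e }
  subsetFunctions : List (Subset (suc n) → Bool)
  subsetFunctions = functions (Subset-finite (suc n)) true (true ∷ false ∷ [])
  Bool-complete : ∀ b → b ∈ₗ true ∷ false ∷ []
  Bool-complete true  = here refl
  Bool-complete false = there (here refl)
  hosts-complete : ∀ H → ∃ λ H′ → H′ ∈ₗ map fromE subsetFunctions × E H ≗ E H′
  hosts-complete H =
    let e , e∈ , e≗ = functions-complete (Subset-finite (suc n)) true (true ∷ false ∷ []) Bool-complete (E H)
    in fromE e , L.∈-map⁺ fromE e∈ , sym ∘ e≗

-- Upper bound on the codegree of F^k_r-free hosts.

free⇒codegree-bound : ∀ κ i → ∃ λ C → ∀ n (H : KGraph (suc κ) n) c → ¬ Contains H (Fsuc (suc κ) i) →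
                      MinCodeg H c → suc i * c ≤ i * n + C
free⇒codegree-bound κ i with C , embed ← embed-Fsuc κ i = C , bound
  where
  bound : ∀ n (H : KGraph (suc κ) n) c → ¬ Contains H (Fsuc (suc κ) i) → MinCodeg H c → suc i * c ≤ i * n + C
  -- Embedding with `W = ⊤` and `t = n ∸ c` would succeed if `suc i * (n ∸ c) + C ≤ n`. Hence the
  -- opposite inequality holds, and adding `suc i * c` removes the truncated subtraction, since
  -- `c ≤ n`.
  bound n H c free (c≤ , S , _ , codeg≡c) = +-cancelˡ-≤ n _ _ (begin
    n + suc i * c                   ≤⟨ +-monoˡ-≤ _ (<⇒≤ (≰⇒> too-big)) ⟩
    suc i * (n ∸ c) + C + suc i * c ≡⟨ +-assoc (suc i * (n ∸ c)) C _ ⟩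
    suc i * (n ∸ c) + (C + suc i * c) ≡⟨ cong (suc i * (n ∸ c) +_) (+-comm C _) ⟩
    suc i * (n ∸ c) + (suc i * c + C) ≡⟨ sym (+-assoc (suc i * (n ∸ c)) _ C) ⟩
    suc i * (n ∸ c) + suc i * c + C ≡⟨ cong (_+ C) (sym (*-distribˡ-+ (suc i) (n ∸ c) c)) ⟩
    suc i * (n ∸ c + c) + C         ≡⟨ cong (λ x → suc i * x + C) (m∸n+n≡m c≤n) ⟩
    suc i * n + C                   ≡⟨ +-assoc n (i * n) C ⟩
    n + (i * n + C)                 ∎)
    where
    open ≤-Reasoning
    c≤n : c ≤ n
    c≤n = subst (_≤ n) (trans (sym (codeg≡∣nbrs∣ H S)) codeg≡c) (∣p∣≤n (nbrs H S))
    few : ∀ S → ∣ S ∣ ≡ κ → ∣ ∁ (nbrs H S) ∣ ≤ n ∸ c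
    few S ∣S∣ = ≤-trans (≤-reflexive (∣∁p∣≡n∸∣p∣ (nbrs H S)))
      (∸-monoʳ-≤ n (subst (c ≤_) (codeg≡∣nbrs∣ H S) (c≤ S ∣S∣)))
    too-big : ¬ (suc i * (n ∸ c) + C ≤ n)
    too-big big with f , inj , _ , edges ← embed H ⊤ few (≤-trans big (≤-reflexive (sym (∣⊤∣≡n n)))) =
      free (f , inj , edges)

-- The balanced host

not-does : {P : Set} (P? : Dec P) → not (does P?) ≡ true → ¬ P
not-does (no ¬p) _ = ¬p

-- The parameter is one less than the number of colours, matching the index `i` of `Fsuc k i`.
colour : ∀ r → Fin n → Fin (suc r)
colour r v = toℕ v mod suc r

monochromatic? : ∀ r (S : Subset n) → Dec (∃ λ i → ∀ v → v ∈ S → colour r v ≡ i)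
monochromatic? r S = Fin.any? λ i → Fin.all? λ v → v ∈? S →-dec colour r v Fin.≟ i

balanced : ∀ k n r → KGraph k n
balanced k n r = record { E = λ S → not (does (monochromatic? r S)) }

balanced-free : ∀ k n r G → ¬ Colourable (suc r) G → ¬ Contains (balanced k n r) G
balanced-free k n r G ¬col (f , _ , edges) = ¬col (colour r ∘ f , λ e → proper e (proj₂ (edges e)))
  where
  proper : ∀ e → E (balanced k n r) (image f (edge G e)) ≡ true →
           ¬ (∃ λ i → ∀ v → v ∈ₗ edge G e → colour r (f v) ≡ i)
  proper e eq (i , mono) = not-does (monochromatic? r (image f (edge G e))) eq (i , λ u u∈ →
    let v , v∈ , u≡ = ∈-image⁻ f (edge G e) u∈ in trans (cong (colour r) u≡) (mono v v∈))

colour-class : ∀ n r → Fin (suc r) → Subset n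
colour-class n r i = ⟦ (λ v → colour r v Fin.≟ i) ⟧

∈-colour-class⁻ : ∀ r (i : Fin (suc r)) {v : Fin n} → v ∈ colour-class n r i → colour r v ≡ i
∈-colour-class⁻ r i = ∈-⟦⟧⁻ (λ v → colour r v Fin.≟ i)

-- Members of a class share their remainder modulo `suc r`, so their quotients are distinct. As
-- these are at most `n / suc r`, the class has at most `n / suc r + 1` members.
colour-class-small : ∀ n r (i : Fin (suc r)) → suc r * ∣ colour-class n r i ∣ ≤ n + suc r
colour-class-small n r i with g , g-inj , g∈C ← choose ∣ colour-class n r i ∣ (colour-class n r i) ≤-refl = begin
  suc r * ∣ C ∣             ≤⟨ *-monoʳ-≤ (suc r) (Fin.injective⇒≤ quotient-inj) ⟩
  suc r * suc (n ℕ./ suc r)   ≡⟨ *-suc (suc r) (n ℕ./ suc r) ⟩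
  suc r + suc r * (n ℕ./ suc r) ≡⟨ +-comm (suc r) _ ⟩
  suc r * (n ℕ./ suc r) + suc r ≡⟨ cong (_+ suc r) (*-comm (suc r) (n ℕ./ suc r)) ⟩
  n ℕ./ suc r * suc r + suc r ≤⟨ +-monoˡ-≤ (suc r) (m/n*n≤m n (suc r)) ⟩
  n + suc r                 ∎
  where
  open ≤-Reasoning
  C : Subset n
  C = colour-class n r i
  quotient : Fin ∣ C ∣ → Fin (suc (n ℕ./ suc r))
  quotient x = fromℕ< (s≤s (/-monoˡ-≤ {n = n} (suc r) (<⇒≤ (Fin.toℕ<n (g x)))))
  same-remainder : ∀ x y → toℕ (g x) % suc r ≡ toℕ (g y) % suc r
  same-remainder x y = trans (sym (Fin.toℕ-fromℕ< _)) (trans (cong toℕ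
    (trans (∈-colour-class⁻ r i (g∈C x)) (sym (∈-colour-class⁻ r i (g∈C y))))) (Fin.toℕ-fromℕ< _))
  quotient-inj : Injective _≡_ _≡_ quotient
  quotient-inj {x} {y} eq = g-inj (Fin.toℕ-injective
    (trans (m≡m%n+[m/n]*n (toℕ (g x)) (suc r))
    (trans (cong₂ (λ a b → a + b * suc r) (same-remainder x y)
                  (trans (sym (Fin.toℕ-fromℕ< _)) (trans (cong toℕ eq) (Fin.toℕ-fromℕ< _))))
           (sym (m≡m%n+[m/n]*n (toℕ (g y)) (suc r))))))

-- Fix `x` in `S`. A vertex outside `S` whose colour differs from that of `x` is a neighbour of `S`,
-- so the neighbours, `S` and the class of `x` cover everything. The error `suc r * k` combines
-- `k - 1` vertices of `S` with the rounding in the class size.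
balanced-codegree : ∀ κ n r (S : Subset n) → ∣ S ∣ ≡ suc κ →
  r * n ≤ suc r * codeg (balanced (suc (suc κ)) n r) S + suc r * suc (suc κ)
balanced-codegree κ n r S ∣S∣ with x , x∈S ← nonempty S (subst (0 <_) (sym ∣S∣) (s≤s z≤n)) =
  +-cancelˡ-≤ n _ _ (begin
    suc r * n                                           ≡⟨ cong (suc r *_) (sym (∣⊤∣≡n n)) ⟩
    suc r * ∣ ⊤ {n} ∣                                   ≤⟨ *-monoʳ-≤ (suc r) (p⊆q⇒∣p∣≤∣q∣ covered) ⟩
    suc r * ∣ N ∪ (S ∪ C) ∣                             ≤⟨ *-monoʳ-≤ (suc r) (≤-trans (∣p∪q∣≤∣p∣+∣q∣ N _) (+-monoʳ-≤ ∣ N ∣ (∣p∪q∣≤∣p∣+∣q∣ S C))) ⟩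
    suc r * (∣ N ∣ + (∣ S ∣ + ∣ C ∣))                   ≡⟨ cong₂ (λ a b → suc r * (a + (b + ∣ C ∣))) (sym (codeg≡∣nbrs∣ H S)) ∣S∣ ⟩
    suc r * (d + (suc κ + ∣ C ∣))                       ≡⟨ expand r d κ ∣ C ∣ ⟩
    suc r * ∣ C ∣ + (suc r * d + suc r * suc κ)         ≤⟨ +-monoˡ-≤ _ (colour-class-small n r (colour r x)) ⟩
    n + suc r + (suc r * d + suc r * suc κ)             ≡⟨ collect n r d κ ⟩
    n + (suc r * d + suc r * suc (suc κ))               ∎)
  where
  open ≤-Reasoning
  H : KGraph (suc (suc κ)) n
  H = balanced (suc (suc κ)) n r
  d : ℕ
  d = codeg H S
  N C : Subset n
  N = nbrs H S
  C = colour-class n r (colour r x)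
  covered : ∀ {v} → v ∈ ⊤ → v ∈ N ∪ (S ∪ C)
  covered {v} _ with v ∈? S | colour r v Fin.≟ colour r x
  ... | yes v∈S | _     = q⊆p∪q N _ (p⊆p∪q C v∈S)
  ... | no v∉S | yes eq = q⊆p∪q N _ (q⊆p∪q S C (∈-⟦⟧⁺ (λ v → colour r v Fin.≟ colour r x) eq))
  ... | no v∉S | no neq = p⊆p∪q (S ∪ C) (∈-tabulate⁺ nbr)
    where
    nbr : not (lookup S v) ∧ not (does (monochromatic? r (S ∪ ⁅ v ⁆))) ≡ true
    nbr with lookup S v in eq
    ... | true  = contradiction (lookup⇒[]= v S eq) v∉S
    ... | false = cong not (dec-false (monochromatic? r (S ∪ ⁅ v ⁆)) λ (i , mono) →
      neq (trans (mono v (q⊆p∪q S ⁅ v ⁆ (x∈⁅x⁆ v))) (sym (mono x (p⊆p∪q ⁅ v ⁆ x∈S)))))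
  expand : ∀ r d κ c → suc r * (d + (suc κ + c)) ≡ suc r * c + (suc r * d + suc r * suc κ)
  expand = solve-∀
  collect : ∀ n r d κ → n + suc r + (suc r * d + suc r * suc κ) ≡ n + (suc r * d + suc r * suc (suc κ))
  collect = solve-∀

-- Convergence of co-ex(n, F) / n

open import Data.Integer using (ℤ; +_; -[1+_])
import Data.Integer.Base as ℤ
import Data.Integer.Properties as ℤ
open import Data.Rational using (ℚ; 0ℚ; _/_; _-_) renaming (∣_∣ to abs)
import Data.Rational.Base as ℚ
import Data.Rational.Properties as ℚ
import Data.Rational.Unnormalised.Base as ℚᵘ
import Data.Rational.Unnormalised.Properties as ℚᵘ

∣m⊖n∣≤ : ∀ {a b D} → a ≤ b + D → b ≤ a + D → ℤ.∣ a ℤ.⊖ b ∣ ≤ D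
∣m⊖n∣≤ {a} {b} {D} a≤ b≤ with ≤-total a b
... | inj₁ a≤b = ≤-trans (≤-reflexive (ℤ.∣⊖∣-≤ a≤b)) (m≤n+o⇒m∸n≤o b a b≤)
... | inj₂ b≤a = ≤-trans (≤-reflexive (cong ℤ.∣_∣ (ℤ.⊖-≥ b≤a))) (m≤n+o⇒m∸n≤o a b a≤)

-- The fractions differ by at most D / (r n), where r = i + 1, so any n > D q works for ε = p / q.
ratio-converges : ∀ i D ε → 0ℚ ℚ.< ε → ∃ λ N → ∀ m → N ≤ m → ∀ c →
  i * suc m ≤ suc i * c + D → suc i * c ≤ i * suc m + D →
  abs ((+ c) / suc m - (+ i) / suc i) ℚ.< ε
ratio-converges i D ε@(ℚ.mkℚ (+ zero) q _) 0<ε with ℚ.toℚᵘ-mono-< 0<ε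
... | ℚᵘ.*<* (ℤ.+<+ ())
ratio-converges i D ε@(ℚ.mkℚ -[1+ p ] q _) 0<ε with ℚ.toℚᵘ-mono-< 0<ε
... | ℚᵘ.*<* ()
ratio-converges i D ε@(ℚ.mkℚ (+ suc p) q _) 0<ε = D * suc q , close
  where
  close : ∀ m → D * suc q ≤ m → ∀ c → i * suc m ≤ suc i * c + D → suc i * c ≤ i * suc m + D →
          abs ((+ c) / suc m - (+ i) / suc i) ℚ.< ε
  close m Dq≤m c lower upper = ℚ.toℚᵘ-cancel-< (begin-strict
    ℚ.toℚᵘ (abs (x - y))                     ≃⟨ ℚ.toℚᵘ-homo-∣-∣ (x - y) ⟩
    ℚᵘ.∣ ℚ.toℚᵘ (x - y) ∣                    ≃⟨ ℚᵘ.∣-∣-cong difference ⟩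
    ℚᵘ.∣ ℚᵘ.mkℚᵘ (+ c) m ℚᵘ.- ℚᵘ.mkℚᵘ (+ i) i ∣ <⟨ ℚᵘ.*<* numerators ⟩
    ℚ.toℚᵘ ε                                 ∎)
    where
    open ℚᵘ.≤-Reasoning
    x y : ℚ
    x = (+ c) / suc m
    y = (+ i) / suc i
    -- Unnormalised fractions keep the denominators `suc m` and `suc i`, so the numerator of the
    -- difference is literally `num`.
    difference : ℚ.toℚᵘ (x - y) ℚᵘ.≃ ℚᵘ.mkℚᵘ (+ c) m ℚᵘ.- ℚᵘ.mkℚᵘ (+ i) i
    difference = ℚᵘ.≃-trans (ℚ.toℚᵘ-homo-+ x (ℚ.- y))
      (ℚᵘ.+-cong (ℚ.toℚᵘ-fromℚᵘ (ℚᵘ.mkℚᵘ (+ c) m))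
        (ℚᵘ.≃-trans (ℚ.toℚᵘ-homo‿- y) (ℚᵘ.-‿cong (ℚ.toℚᵘ-fromℚᵘ (ℚᵘ.mkℚᵘ (+ i) i)))))
    num : ℤ
    num = + c ℤ.* + suc i ℤ.+ (ℤ.- (+ i)) ℤ.* + suc m
    num≡ : num ≡ (suc i * c) ℤ.⊖ (i * suc m)
    num≡ = trans (cong₂ ℤ._+_ (trans (sym (ℤ.pos-* c (suc i))) (cong +_ (*-comm c (suc i))))
                              (trans (sym (ℤ.neg-distribˡ-* (+ i) (+ suc m))) (cong ℤ.-_ (sym (ℤ.pos-* i (suc m))))))
                 (ℤ.m-n≡m⊖n (suc i * c) (i * suc m))
    -- The chain is `∣num∣ * suc q ≤ D * suc q ≤ m < suc m`, followed by multiplication by the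
    -- positive factors `suc i` and `suc p`.
    small : ℤ.∣ num ∣ * suc q < suc p * (suc m * suc i)
    small = ≤-<-trans (*-monoˡ-≤ (suc q) (subst (λ z → ℤ.∣ z ∣ ≤ D) (sym num≡) (∣m⊖n∣≤ {suc i * c} upper lower)))
      (<-≤-trans (s≤s Dq≤m) (≤-trans (m≤m*n (suc m) (suc i)) (m≤n*m (suc m * suc i) (suc p))))
    numerators : + ℤ.∣ num ∣ ℤ.* + suc q ℤ.< + suc p ℤ.* + (suc m * suc i)
    numerators = subst₂ ℤ._<_ (ℤ.pos-* ℤ.∣ num ∣ (suc q)) (ℤ.pos-* (suc p) (suc m * suc i)) (ℤ.+<+ small)

-- Combination of the two bounds into the value of γ.

IsCoex-lower : ∀ κ n i G c → ¬ Colourable (suc i) G → suc κ ≤ n → IsCoex (suc (suc κ)) n G c →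
               i * n ≤ suc i * c + suc i * suc (suc κ)
IsCoex-lower κ n i G c ¬col k-1≤n (_ , maximal) = bound (min-codegree-exists host k-1≤n)
  where
  open ≤-Reasoning
  k : ℕ
  k = suc (suc κ)
  host : KGraph k n
  host = balanced k n i
  bound : ∃ (MinCodeg host) → i * n ≤ suc i * c + suc i * k
  -- The codegree estimate is applied at a set attaining the minimum `c₀`; maximality of `c` over
  -- free hosts then gives `c₀ ≤ c`.
  bound (c₀ , min₀@(_ , S , ∣S∣ , codeg≡c₀)) = begin
    i * n                             ≤⟨ balanced-codegree κ n i S ∣S∣ ⟩
    suc i * codeg host S + suc i * k  ≡⟨ cong (λ x → suc i * x + suc i * k) codeg≡c₀ ⟩
    suc i * c₀ + suc i * k            ≤⟨ +-monoˡ-≤ (suc i * k) (*-monoʳ-≤ (suc i)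
                                           (maximal host c₀ (balanced-free k n i G ¬col) min₀)) ⟩
    suc i * c + suc i * k             ∎

module _ (κ i : ℕ) (G : AbsGraph) (finV : Finite (V G)) (finIx : Finite (Ix G))
         (¬col : ¬ Colourable (suc i) G) (C : ℕ)
         (upper : (n : ℕ) (H : KGraph (suc (suc κ)) n) (c : ℕ) →
                  ¬ Contains H G → MinCodeg H c → suc i * c ≤ i * n + C) where

  private
    k D : ℕ
    k = suc (suc κ)
    -- One constant covers both errors: `suc i * k` from the balanced host and `C` from the
    -- embedding.
    D = suc i * k + C

    IsCoex-upper : ∀ n c → IsCoex k n G c → suc i * c ≤ i * n + D
    IsCoex-upper n c ((H , H-free , H-min) , _) =
      ≤-trans (upper n H c H-free H-min) (+-monoʳ-≤ (i * n) (m≤n+m C (suc i * k)))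

  Gamma-from-bounds : Gamma≡ k G ((+ i) / suc i)
  Gamma-from-bounds ε 0<ε with N , close ← ratio-converges i D ε 0<ε =
    -- The summand `κ` ensures `k - 1 ≤ suc m`, so that minimum codegrees exist on `suc m` vertices.
    N + κ , λ m N+κ≤m →
      let k-1≤n = s≤s (m+n≤o⇒n≤o N N+κ≤m)
          c , isCoex = coex-exists G finV finIx k-1≤n (balanced k (suc m) i) (balanced-free k (suc m) i G ¬col)
          lower = ≤-trans (IsCoex-lower κ (suc m) i G c ¬col k-1≤n isCoex)
                          (+-monoʳ-≤ (suc i * c) (m≤m+n (suc i * k) C))
      in c , isCoex , close m (m+n≤o⇒m≤o N N+κ≤m) c lower (IsCoex-upper (suc m) c isCoex)

Fsuc-Gamma : ∀ κ i → Gamma≡ (suc (suc κ)) (Fsuc (suc (suc κ)) i) ((+ i) / suc i)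
Fsuc-Gamma κ i =
  Gamma-from-bounds κ i (Fsuc k i) (Fsuc-V-finite k i) (Fsuc-Ix-finite k i) (Fsuc-not-colourable κ i)
    -- The argument is `suc κ` because that bound concerns hosts of uniformity one more than its
    -- first argument.
    (proj₁ (free⇒codegree-bound (suc κ) i)) (proj₂ (free⇒codegree-bound (suc κ) i))
  where
  k : ℕ
  k = suc (suc κ)

theorem3p2 : (k : ℕ) → 3 ≤ k → (r : ℕ) → .{{_ : NonZero r}} →
    ¬ Colourable r (F k r) × Gamma≡ k (F k r) ((+ (r ∸ 1)) / r)
theorem3p2 (suc (suc κ)) (s≤s (s≤s _)) (suc i) = Fsuc-not-colourable κ i , Fsuc-Gamma κ i
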